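{- If $\langle\mathbb A,\sigma\restriction\mathbb A\rangle$ is an elementary substructure of $\langle\mathcal P(\omega)/\mathrm{Fin},\sigma\rangle$, then $\langle\mathbb A,\sigma\restriction\mathbb A\rangle$ is polarized.
   Context: $\mathcal P(\omega)/\mathrm{Fin}$ is $\mathcal P(\omega)$ modulo finite sets, $\sigma([A])=[A+1]$. Elementary substructure: $\mathbb A$ is a subalgebra closed under $\sigma,\sigma^{ -1}$ such that every first-order formula with parameters from $\mathbb A$, in the language with constants $\mathbf 0,\mathbf 1$, the Boolean operations, $\le$, and unary symbols for the automorphism and its inverse, has the same truth value in $\langle\mathbb A,\sigma\restriction\mathbb A\rangle$ and in $\langle\mathcal P(\omega)/\mathrm{Fin},\sigma\rangle$. For a Boolean algebra $\mathbb A$ with automorphism $\alpha$: partitions are finite sets of nonzero pairwise disjoint elements with join $\mathbf 1$; refinement and the natural map $\pi$ are as usual; $x\to_\alpha y$ iff $\alpha(x)\wedge y\ne\mathbf 0$. An epimorphism of finite digraphs $\phi:\langle\mathcal V,\to_{\mathcal V}\rangle\to\langle\mathcal U,\to_{\mathcal U}\rangle$ is a surjection with $u\to_{\mathcal U}u'$ iff some $v\in\phi^{ -1}(u),v'\in\phi^{ -1}(u')$ have $v\to_{\mathcal V}v'$. A virtual refinement of $\langle\mathcal A,\to_\alpha\rangle$ is $(\phi,\langle\mathcal V,\to\rangle)$ with $\mathcal V$ strongly connected and $\phi$ an epimorphism onto $\langle\mathcal A,\to_\alpha\rangle$; a partition $\mathcal A'$ realizes it if $\mathcal A'$ refines $\mathcal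 A$ and a digraph isomorphism $\psi:\langle\mathcal V,\to\rangle\to\langle\mathcal A',\to_\alpha\rangle$ has $\pi\circ\psi=\phi$. Epimorphisms $\phi,\psi$ onto the same digraph from strongly connected digraphs are compatible if some strongly connected $\mathcal W$ has epimorphisms $\bar\phi,\bar\psi$ onto their domains with $\phi\circ\bar\phi=\psi\circ\bar\psi$. A virtual refinement is polarized if either some partition realizes it or some partition $\mathcal A'$ refining $\mathcal A$ has its natural map incompatible with $\phi$; the system is polarized if all virtual refinements of all partitions' digraphs are polarized. -}

module Defs where

open import Data.Nat using (ℕ; zero; suc; _≤_)
open import Data.Bool using (Bool; true; false; not) renaming (_∧_ to _∧ᵇ_; _∨_ to _∨ᵇ_)
open import Data.Fin using (Fin) renaming (zero to fzero; suc to fsuc)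
open import Data.Product using (Σ; _×_; _,_)
open import Data.Sum using (_⊎_)
open import Data.Unit using (⊤)
open import Data.Empty using (⊥)
open import Relation.Nullary using (¬_)
open import Relation.Binary.PropositionalEquality using (_≡_)
open import Relation.Binary.Construct.Closure.ReflexiveTransitive using (Star)
open import Function.Bundles using (_⇔_)

-- P(ω)/Fin as the setoid of subsets of ℕ (characteristic functions)
-- modulo finite difference.

Sub : Set
Sub = ℕ → Bool

_≈_ : Sub → Sub → Set
A ≈ B = Σ ℕ λ n → ∀ m → n ≤ m → A m ≡ B m

𝟎 𝟏 : Sub
𝟎 _ = false
𝟏 _ = true

_⊓_ _⊔_ : Sub → Sub → Sub
(A ⊓ B) m = A m ∧ᵇ B m
(A ⊔ B) m = A m ∨ᵇ B m

_ᶜ : Sub → Sub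
(A ᶜ) m = not (A m)

σ : Sub → Sub
σ A zero    = false
σ A (suc m) = A m

σ⁻ : Sub → Sub
σ⁻ A m = A (suc m)

_≤ᴮ_ : Sub → Sub → Set
A ≤ᴮ B = (A ⊓ (B ᶜ)) ≈ 𝟎

Nz : Sub → Set
Nz A = ¬ (A ≈ 𝟎)

⨆ : ∀ n → (Fin n → Sub) → Sub
⨆ zero    f = 𝟎
⨆ (suc n) f = f fzero ⊔ ⨆ n (λ i → f (fsuc i))

-- Subalgebras closed under σ, σ⁻¹.  A subalgebra 𝔸 is given by a
-- predicate on representatives which respects =* (i.e. a set of classes).

record IsSubalgebra (InA : Sub → Set) : Set where
  field
    resp   : ∀ {A B} → A ≈ B → InA A → InA B
    has𝟎   : InA 𝟎
    has𝟏   : InA 𝟏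
    meet   : ∀ {A B} → InA A → InA B → InA (A ⊓ B)
    join   : ∀ {A B} → InA A → InA B → InA (A ⊔ B)
    compl  : ∀ {A} → InA A → InA (A ᶜ)
    clσ    : ∀ {A} → InA A → InA (σ A)
    clσ⁻   : ∀ {A} → InA A → InA (σ⁻ A)

-- First-order language: constants 𝟎, 𝟏, Boolean operations, ≤,
-- unary symbols for the automorphism and its inverse (and equality).
-- Variables are de Bruijn indices; parameters are assignments to free
-- variables.

data Term (n : ℕ) : Set where
  var       : Fin n → Term n
  t𝟎 t𝟏     : Term n
  _t∧_ _t∨_ : Term n → Term n → Term n
  tᶜ tσ tσ⁻ : Term n → Term n

data Formula : ℕ → Set where
  _f≡_ _f≤_ : ∀ {n} → Term n → Term n → Formula n
  f⊥        : ∀ {n} → Formula n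
  f¬        : ∀ {n} → Formula n → Formula n
  _f∧_ _f∨_ _f⇒_ : ∀ {n} → Formula n → Formula n → Formula n
  f∀ f∃     : ∀ {n} → Formula (suc n) → Formula n

Env : ℕ → Set
Env n = Fin n → Sub

extend : ∀ {n} → Sub → Env n → Env (suc n)
extend x ρ fzero    = x
extend x ρ (fsuc i) = ρ i

⟦_⟧t : ∀ {n} → Term n → Env n → Sub
⟦ var i ⟧t ρ   = ρ i
⟦ t𝟎 ⟧t ρ      = 𝟎
⟦ t𝟏 ⟧t ρ      = 𝟏
⟦ s t∧ t ⟧t ρ  = ⟦ s ⟧t ρ ⊓ ⟦ t ⟧t ρ
⟦ s t∨ t ⟧t ρ  = ⟦ s ⟧t ρ ⊔ ⟦ t ⟧t ρ
⟦ tᶜ t ⟧t ρ    = ⟦ t ⟧t ρ ᶜ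
⟦ tσ t ⟧t ρ    = σ (⟦ t ⟧t ρ)
⟦ tσ⁻ t ⟧t ρ   = σ⁻ (⟦ t ⟧t ρ)

-- satisfaction in the structure whose universe is the classes of the
-- representatives satisfying D (quantifiers range over D)
Sat : (D : Sub → Set) → ∀ {n} → Formula n → Env n → Set
Sat D (s f≡ t) ρ = ⟦ s ⟧t ρ ≈ ⟦ t ⟧t ρ
Sat D (s f≤ t) ρ = ⟦ s ⟧t ρ ≤ᴮ ⟦ t ⟧t ρ
Sat D f⊥ ρ       = ⊥
Sat D (f¬ φ) ρ   = ¬ Sat D φ ρ
Sat D (φ f∧ ψ) ρ = Sat D φ ρ × Sat D ψ ρ
Sat D (φ f∨ ψ) ρ = Sat D φ ρ ⊎ Sat D ψ ρ
Sat D (φ f⇒ ψ) ρ = Sat D φ ρ → Sat D ψ ρ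
Sat D (f∀ φ) ρ   = (x : Sub) → D x → Sat D φ (extend x ρ)
Sat D (f∃ φ) ρ   = Σ Sub λ x → D x × Sat D φ (extend x ρ)

Everything : Sub → Set
Everything _ = ⊤

ElementarySubstructure : (InA : Sub → Set) → Set
ElementarySubstructure InA =
  IsSubalgebra InA ×
  (∀ {n} (φ : Formula n) (ρ : Env n) → (∀ i → InA (ρ i)) →
     Sat InA φ ρ ⇔ Sat Everything φ ρ)

record Digraph : Set₁ where
  field
    size : ℕ
    edge : Fin size → Fin size → Set

open Digraph public

StronglyConnected : Digraph → Set
StronglyConnected G = ∀ u v → Star (edge G) u v

Surjective : ∀ {m n} → (Fin m → Fin n) → Set
Surjective {m} f = ∀ u → Σ (Fin m) λ v → f v ≡ u

Injective : ∀ {m n} → (Fin m → Fin n) → Set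
Injective f = ∀ v w → f v ≡ f w → v ≡ w

IsEpimorphism : (V U : Digraph) → (Fin (size V) → Fin (size U)) → Set
IsEpimorphism V U φ =
  Surjective φ ×
  (∀ u u' → edge U u u' ⇔
     Σ (Fin (size V)) λ v → Σ (Fin (size V)) λ v' →
       φ v ≡ u × φ v' ≡ u' × edge V v v')

IsIsomorphism : (V U : Digraph) → (Fin (size V) → Fin (size U)) → Set
IsIsomorphism V U ψ =
  Injective ψ × Surjective ψ ×
  (∀ v v' → edge V v v' ⇔ edge U (ψ v) (ψ v'))

Compatible : (U V V' : Digraph) →
  (Fin (size V) → Fin (size U)) → (Fin (size V') → Fin (size U)) → Set₁
Compatible U V V' φ ψ =
  Σ Digraph λ W → StronglyConnected W ×
  Σ (Fin (size W) → Fin (size V)) λ φ̄ → IsEpimorphism W V φ̄ ×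
  Σ (Fin (size W) → Fin (size V')) λ ψ̄ → IsEpimorphism W V' ψ̄ ×
  (∀ w → φ (φ̄ w) ≡ ψ (ψ̄ w))

record Partition (InA : Sub → Set) : Set where
  field
    card  : ℕ
    part  : Fin card → Sub
    inA   : ∀ i → InA (part i)
    nz    : ∀ i → Nz (part i)
    disj  : ∀ i j → ¬ i ≡ j → (part i ⊓ part j) ≈ 𝟎
    cover : ⨆ card part ≈ 𝟏

open Partition public

digraphOf : ∀ {InA} → Partition InA → Digraph
digraphOf P = record
  { size = card P
  ; edge = λ i j → Nz (σ (part P i) ⊓ part P j) }

-- 𝒜' refines 𝒜, with π the natural map (each a' ∈ 𝒜' lies below π(a') ∈ 𝒜;
-- such π is unique when it exists)
IsNaturalMap : ∀ {InA} (P' P : Partition InA) → (Fin (card P') → Fin (card P)) → Set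
IsNaturalMap P' P π = ∀ i → part P' i ≤ᴮ part P (π i)

record VirtualRefinement {InA : Sub → Set} (P : Partition InA) : Set₁ where
  field
    V      : Digraph
    strong : StronglyConnected V
    φ      : Fin (size V) → Fin (card P)
    epi    : IsEpimorphism V (digraphOf P) φ

open VirtualRefinement public

Realizes : ∀ {InA} {P : Partition InA} → Partition InA → VirtualRefinement P → Set
Realizes {P = P} P' R =
  Σ (Fin (card P') → Fin (card P)) λ π → IsNaturalMap P' P π ×
  Σ (Fin (size (V R)) → Fin (card P')) λ ψ →
    IsIsomorphism (V R) (digraphOf P') ψ × (∀ v → π (ψ v) ≡ φ R v)

Polarized : ∀ {InA} {P : Partition InA} → VirtualRefinement P → Set₁
Polarized {InA} {P} R =
  (Σ (Partition InA) λ P' → Realizes P' R) ⊎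
  (Σ (Partition InA) λ P' →
     Σ (Fin (card P') → Fin (card P)) λ π → IsNaturalMap P' P π ×
       ¬ Compatible (digraphOf P) (V R) (digraphOf P') (φ R) π)

PolarizedSystem : (InA : Sub → Set) → Set₁
PolarizedSystem InA = (P : Partition InA) (R : VirtualRefinement P) → Polarized R

{-# OPTIONS --safe #-}
module Submission where

-- A partition is an infinite word x over its parts, and a realization of a virtual refinement φ : V → U is a
-- lift of x along φ to a walk in V that uses every edge of V infinitely often.  By Ramsey, x can be cut into
-- blocks over which the same lifts exist: the same pairs of end points, and the same edges passed between them.
-- Refine x by remembering, at each position, the block boundaries and the lifts available since the last
-- boundary.  If this refinement is compatible with φ, a closed walk in the common cover passes a boundary and
-- covers all edges of V.  It need not occur in x, but it is a concatenation of blocks of the common type, so its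
-- lift can be imitated over consecutive blocks of x, again and again, which gives a realization.
-- The existence of a partition with prescribed digraph refining a given one is a first-order formula, so the
-- partitions found in 𝒫(ω)/Fin can be replaced by partitions in 𝔸.

open import Defs
open import Level using (0ℓ)
open import Axiom.ExcludedMiddle using (ExcludedMiddle)
open import Data.Nat using (ℕ; zero; suc; _+_; _*_; _^_; _∸_; _≤_; _<_; z≤n; s≤s) renaming (_⊔_ to _⊔ⁿ_)
open import Data.Nat.Properties
open import Data.Bool using (Bool; true; false; not; _∧_; if_then_else_)
open import Data.Bool.Properties using (¬-not)
open import Data.Fin using (Fin; toℕ; punchIn; punchOut; finToFun; funToFin) renaming (zero to fzero; suc to fsuc)
open import Data.Fin.Properties using (toℕ<n; toℕ-injective; punchIn-punchOut; finToFun-funToFin; *↔×; 2↔Bool; ¬Fin0)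
  renaming (_≟_ to _≟ᶠ_)
open import Data.Product using (Σ; _×_; _,_; proj₁; proj₂)
open import Data.Product.Function.NonDependent.Propositional using (_×-↔_)
open import Data.Sum using (_⊎_; inj₁; inj₂)
open import Data.Empty using (⊥; ⊥-elim)
open import Function using (_∘_; id)
open import Function.Bundles using (_⇔_; mk⇔; Equivalence; _↔_; Inverse)
open import Function.Properties.Inverse using (↔-refl; ↔-sym; ↔-trans)
open import Relation.Nullary using (¬_; Dec; yes; no; does)
open import Relation.Nullary.Decidable using (dec-true; dec-false; decidable-stable)
open import Relation.Nullary.Negation using (contradiction)
open import Relation.Binary.PropositionalEquality using (_≡_; _≢_; refl; sym; trans; cong; cong₂; subst; subst₂)
open import Relation.Binary.Construct.Closure.ReflexiveTransitive using (Star; ε; _◅_; _◅◅_)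

open Equivalence using (to; from)

-- Properties of almost all and of infinitely many positions

Eventually : (ℕ → Set) → Set
Eventually P = Σ ℕ λ N → ∀ k → N ≤ k → P k

Frequently : (ℕ → Set) → Set
Frequently P = ∀ N → Σ ℕ λ k → N ≤ k × P k

FrequentTransition : ∀ {K} → (ℕ → Fin K) → Fin K → Fin K → Set
FrequentTransition s u v = Frequently λ k → s k ≡ u × s (suc k) ≡ v

eventually-∀ : ∀ {K} {P : Fin K → ℕ → Set} → (∀ i → Eventually (P i)) → Eventually (λ k → ∀ i → P i k)
eventually-∀ {zero}  _ = 0 , λ _ _ ()
eventually-∀ {suc K} h with h fzero | eventually-∀ (h ∘ fsuc)
... | M , p | N , q = M ⊔ⁿ N , λ where
  k le fzero    → p k (≤-trans (m≤m⊔n M N) le)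
  k le (fsuc i) → q k (≤-trans (m≤n⊔m M N) le) i

frequently⇒Nz : ∀ {A} → Frequently (λ k → A k ≡ true) → Nz A
frequently⇒Nz A∞ (N , A≡0) with A∞ N
... | k , N≤k , Ak with trans (sym Ak) (A≡0 k N≤k)
... | ()

∧-true : ∀ {a b} → (a ∧ b) ≡ true → a ≡ true × b ≡ true
∧-true {true} {true} _ = refl , refl

step-mono-< : ∀ (s : ℕ → ℕ) → (∀ i → s i < s (suc i)) → ∀ {i j} → i < j → s i < s j
step-mono-< s inc {i} {suc j} (s≤s i≤j) with m≤n⇒m<n∨m≡n i≤j
... | inj₁ i<j  = <-trans (step-mono-< s inc i<j) (inc j)
... | inj₂ refl = inc j

-- Walks and their repetition

module _ {A : Set} {T : A → A → Set} where

  Uses : (∀ {a b} → T a b → Set) → ∀ {a b} → Star T a b → Set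
  Uses Q ε       = ⊥
  Uses Q (t ◅ p) = Q t ⊎ Uses Q p

  uses-◅◅ˡ : ∀ (Q : ∀ {a b} → T a b → Set) {a b c} (p : Star T a b) {q : Star T b c} → Uses Q p → Uses Q (p ◅◅ q)
  uses-◅◅ˡ Q (t ◅ p) (inj₁ u) = inj₁ u
  uses-◅◅ˡ Q (t ◅ p) (inj₂ u) = inj₂ (uses-◅◅ˡ Q p u)

  uses-◅◅ʳ : ∀ (Q : ∀ {a b} → T a b → Set) {a b c} (p : Star T a b) {q : Star T b c} → Uses Q q → Uses Q (p ◅◅ q)
  uses-◅◅ʳ Q ε       u = u
  uses-◅◅ʳ Q (t ◅ p) u = inj₂ (uses-◅◅ʳ Q p u)

  -- Loops at one base point concatenate, so finitely many demands are met by a single loop. The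
  -- guard `C` lets an index without a demand contribute any loop.
  collect-loops : ∀ {K} (C : Fin K → Set) (Q : Fin K → ∀ {a b} → T a b → Set) {a} →
    (∀ i → Σ (Star T a a) λ p → C i → Uses (Q i) p) →
    Σ (Star T a a) λ p → ∀ i → C i → Uses (Q i) p
  collect-loops {zero}  C Q loop = ε , λ ()
  collect-loops {suc K} C Q loop with loop fzero | collect-loops (C ∘ fsuc) (λ i → Q (fsuc i)) (loop ∘ fsuc)
  ... | p , up | q , uq = p ◅◅ q , λ where
    fzero    c → uses-◅◅ˡ (Q fzero) p (up c)
    (fsuc i) c → uses-◅◅ʳ (Q (fsuc i)) p (uq i c)

  -- The infinite walk that goes round one closed walk forever. Splitting off `first` makes the
  -- closed walk nonempty, so that every state has a current edge.
  module Repeat {a₀ a₁ : A} (first : T a₀ a₁) (rest : Star T a₁ a₀) where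

    record State : Set where
      constructor state
      field
        {source target} : A
        edge₀           : T source target
        remaining       : Star T target a₀

    open State

    next : State → State
    next (state t ε)        = state first rest
    next (state t (t′ ◅ p)) = state t′ p

    source-next : ∀ s → source (next s) ≡ target s
    source-next (state t ε)        = refl
    source-next (state t (t′ ◅ p)) = refl

    iterate : ℕ → State → State
    iterate zero    s = s
    iterate (suc k) s = iterate k (next s)

    iterate-suc : ∀ k s → iterate (suc k) s ≡ next (iterate k s)
    iterate-suc zero    s = refl
    iterate-suc (suc k) s = iterate-suc k (next s)

    iterate-+ : ∀ j k s → iterate (j + k) s ≡ iterate k (iterate j s)
    iterate-+ zero    k s = refl
    iterate-+ (suc j) k s = iterate-+ j k (next s)

    start : State
    start = state first rest

    returns : ∀ {a b} (t : T a b) p → Σ ℕ λ k → iterate k (state t p) ≡ start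
    returns t ε        = 1 , refl
    returns t (t′ ◅ p) with returns t′ p
    ... | k , eq = suc k , eq

    reaches : ∀ (Q : ∀ {a b} → T a b → Set) {a b} (t : T a b) p → Uses Q (t ◅ p) →
      Σ ℕ λ k → Q (edge₀ (iterate k (state t p)))
    reaches Q t p        (inj₁ q) = 0 , q
    reaches Q t (t′ ◅ p) (inj₂ u) with reaches Q t′ p u
    ... | k , q = suc k , q

    vertex : ℕ → A
    vertex i = source (iterate i start)

    target-vertex : ∀ i → target (iterate i start) ≡ vertex (suc i)
    target-vertex i = sym (trans (cong source (iterate-suc i start)) (source-next (iterate i start)))

    edgeAt : ∀ i → T (vertex i) (vertex (suc i))
    edgeAt i = subst (T (vertex i)) (target-vertex i) (edge₀ (iterate i start))

    transport-Q : ∀ (Q : ∀ {a b} → T a b → Set) {a b c} (eq : b ≡ c) (t : T a b) → Q t → Q (subst (T a) eq t)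
    transport-Q Q refl t q = q

    frequently-used : ∀ (Q : ∀ {a b} → T a b → Set) → Uses Q (first ◅ rest) → Frequently (λ i → Q (edgeAt i))
    frequently-used Q u N with reaches Q first rest u
    ... | k , q with returns (edge₀ (iterate N start)) (remaining (iterate N start))
    -- From time `N`, `l` steps lead back to `start` and `k` more to the wanted edge.
    ... | l , eq = N + (l + k) , m≤m+n N (l + k) , transport-Q Q (target-vertex (N + (l + k))) _ q′
      where
      at : iterate (N + (l + k)) start ≡ iterate k start
      at = trans (iterate-+ N (l + k) start) (trans (iterate-+ l k (iterate N start)) (cong (iterate k) eq))
      q′ : Q (edge₀ (iterate (N + (l + k)) start))
      q′ = subst (λ s → Q (edge₀ s)) (sym at) q

-- Division of ω into blocks

-- Consecutive blocks of lengths 1 + gap 0, 1 + gap 1, … laid out along ℕ.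
module Clock (gap : ℕ → ℕ) where

  -- `left` counts down to the end of the block, so `tick` needs no comparison of `offset` with
  -- `gap`; `OffsetLeft` is the invariant tying them.
  record Time : Set where
    constructor time
    field
      block offset left : ℕ

  open Time public

  tick : Time → Time
  tick (time i d zero)    = time (suc i) 0 (gap (suc i))
  tick (time i d (suc r)) = time i (suc d) r

  clock : ℕ → Time
  clock zero    = time 0 0 (gap 0)
  clock (suc j) = tick (clock j)

  OffsetLeft : Time → Set
  OffsetLeft t = offset t + left t ≡ gap (block t)

  tick-offset+left : ∀ t → OffsetLeft t → OffsetLeft (tick t)
  tick-offset+left (time i d zero)    eq = refl
  tick-offset+left (time i d (suc r)) eq = trans (sym (+-suc d r)) eq

  offset+left : ∀ j → OffsetLeft (clock j)
  offset+left zero    = refl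
  offset+left (suc j) = tick-offset+left (clock j) (offset+left j)

  offset≤gap : ∀ j → offset (clock j) ≤ gap (block (clock j))
  offset≤gap j = subst (offset (clock j) ≤_) (offset+left j) (m≤m+n _ _)

  data Tick (t t′ : Time) : Set where
    inside : block t′ ≡ block t → offset t′ ≡ suc (offset t) → Tick t t′
    across : block t′ ≡ suc (block t) → offset t′ ≡ 0 → offset t ≡ gap (block t) → Tick t t′

  tick-view : ∀ t → OffsetLeft t → Tick t (tick t)
  tick-view (time i d zero)    eq = across refl refl (trans (sym (+-identityʳ d)) eq)
  tick-view (time i d (suc r)) eq = inside refl refl

  clock-view : ∀ j → Tick (clock j) (clock (suc j))
  clock-view j = tick-view (clock j) (offset+left j)

  -- The bound `i ≤ j` turns an event in infinitely many blocks into one at infinitely many times.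
  visits : ∀ i d r → d + r ≡ gap i → Σ ℕ λ j → i ≤ j × clock j ≡ time i d r
  visits zero    zero    r refl = 0 , z≤n , refl
  visits (suc i) zero    r refl with visits i (gap i) 0 (+-identityʳ (gap i))
  ... | j , i≤j , eq = suc j , s≤s i≤j , cong tick eq
  visits i       (suc d) r eq with visits i d (suc r) (trans (+-suc d r) eq)
  ... | j , i≤j , at = suc j , ≤-trans i≤j (n≤1+n j) , cong tick at

  visits-offset : ∀ i d → d ≤ gap i → Σ ℕ λ j → i ≤ j × clock j ≡ time i d (gap i ∸ d)
  visits-offset i d d≤ = visits i d (gap i ∸ d) (m+[n∸m]≡n d≤)

  module _ (n : ℕ → ℕ) (n-suc : ∀ i → n (suc i) ≡ n i + suc (gap i)) where

    position : ∀ j → n (block (clock j)) + offset (clock j) ≡ n 0 + j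
    position zero    = refl
    position (suc j) = go (clock j) (clock (suc j)) (clock-view j) (position j)
      where
      go : ∀ t t′ → Tick t t′ → n (block t) + offset t ≡ n 0 + j → n (block t′) + offset t′ ≡ n 0 + suc j
      go (time i d _) (time _ _ _) (inside refl refl) eq =
        trans (+-suc (n i) d) (trans (cong suc eq) (sym (+-suc (n 0) j)))
      go (time i d _) (time _ _ _) (across refl refl refl) eq =
        trans (+-identityʳ _) (trans (n-suc i) (trans (+-suc (n i) d) (trans (cong suc eq) (sym (+-suc (n 0) j)))))

-- Words and partitions

↔-× : ∀ {A B : Set} {k l} → A ↔ Fin k → B ↔ Fin l → (A × B) ↔ Fin (k * l)
↔-× f g = ↔-trans (f ×-↔ g) (↔-sym *↔×)

cell : ∀ {K} → (ℕ → Fin K) → Fin K → Sub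
cell s v k = does (s k ≟ᶠ v)

module _ {K} (s : ℕ → Fin K) where

  cell-true : ∀ {v k} → cell s v k ≡ true ⇔ s k ≡ v
  cell-true {v} {k} = mk⇔ sound (dec-true (s k ≟ᶠ v))
    where
    sound : cell s v k ≡ true → s k ≡ v
    sound eq with s k ≟ᶠ v
    ... | yes p = p

  cells-disjoint : ∀ {u v} → u ≢ v → (cell s u ⊓ cell s v) ≈ 𝟎
  cells-disjoint {u} {v} u≢v = 0 , λ k _ → go k
    where
    go : ∀ k → (cell s u ⊓ cell s v) k ≡ false
    go k with s k ≟ᶠ u | s k ≟ᶠ v
    ... | yes p | yes q = contradiction (trans (sym p) q) u≢v
    ... | yes _ | no _  = refl
    ... | no _  | _     = refl

⨆-true : ∀ n (f : Fin n → Sub) {k} → ⨆ n f k ≡ true → Σ (Fin n) λ i → f i k ≡ true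
⨆-true (suc n) f {k} eq with f fzero k in f₀
... | true  = fzero , f₀
... | false with ⨆-true n (f ∘ fsuc) eq
...   | i , fi = fsuc i , fi

true-⨆ : ∀ {n} (f : Fin n → Sub) {k} i → f i k ≡ true → ⨆ n f k ≡ true
true-⨆ f fzero    eq rewrite eq = refl
true-⨆ f {k} (fsuc i) eq with f fzero k
... | true  = refl
... | false = true-⨆ (f ∘ fsuc) i eq

⨆-cong : ∀ n {f g : Fin n → Sub} → (∀ i → f i ≡ g i) → ⨆ n f ≡ ⨆ n g
⨆-cong zero    eq = refl
⨆-cong (suc n) eq = cong₂ _⊔_ (eq fzero) (⨆-cong n (eq ∘ fsuc))

-- Finitely many parts are disjoint and cover ω up to finite sets, so beyond some bound each
-- position lies in exactly one of them.
word-of : ∀ {InA} (P : Partition InA) →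
  Σ (ℕ → Fin (card P)) λ x → Eventually λ k → ∀ i → part P i k ≡ true ⇔ x k ≡ i
word-of P with cover P | eventually-∀ (λ i → eventually-∀ (λ j → disjoint i j))
  where
  disjoint : ∀ i j → Eventually λ k → i ≢ j → (part P i ⊓ part P j) k ≡ false
  disjoint i j with i ≟ᶠ j
  ... | yes i≡j = 0 , λ _ _ i≢j → contradiction i≡j i≢j
  ... | no i≢j with disj P i j i≢j
  ...   | N , h = N , λ k le _ → h k le
... | M , covers | N , disjoint = x , M ⊔ⁿ N , spec
  where
  -- Positions before `M`, which no part need contain, borrow the letter at `M`.
  choice : ∀ k → Σ (Fin (card P)) λ i → part P i (k ⊔ⁿ M) ≡ true
  choice k = ⨆-true (card P) (part P) (covers (k ⊔ⁿ M) (m≤n⊔m k M))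
  x : ℕ → Fin (card P)
  x k = proj₁ (choice k)
  spec : ∀ k → M ⊔ⁿ N ≤ k → ∀ i → part P i k ≡ true ⇔ x k ≡ i
  spec k le i = mk⇔ unique λ { refl → holds }
    where
    holds : part P (x k) k ≡ true
    holds = subst (λ l → part P (x k) l ≡ true) (m≥n⇒m⊔n≡m (≤-trans (m≤m⊔n M N) le)) (proj₂ (choice k))
    unique : part P i k ≡ true → x k ≡ i
    unique eq with x k ≟ᶠ i
    ... | yes p = p
    ... | no x≢i = contradiction
            (trans (sym (cong₂ _∧_ holds eq)) (disjoint k (≤-trans (m≤n⊔m M N) le) (x k) i x≢i)) λ ()

-- Refinements described by first-order formulas

⋀ : ∀ {n} K → (Fin K → Formula n) → Formula n
⋀ zero    φs = f¬ f⊥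
⋀ (suc K) φs = φs fzero f∧ ⋀ K (φs ∘ fsuc)

t⨆ : ∀ {n} K → (Fin K → Term n) → Term n
t⨆ zero    ts = t𝟎
t⨆ (suc K) ts = ts fzero t∨ t⨆ K (ts ∘ fsuc)

-- K + m, computed so that f∃* below type-checks without transport.
_⊕_ : ℕ → ℕ → ℕ
zero  ⊕ m = m
suc K ⊕ m = K ⊕ suc m

old : ∀ K {m} → Fin m → Fin (K ⊕ m)
old zero    i = i
old (suc K) i = old K (fsuc i)

new : ∀ K {m} → Fin K → Fin (K ⊕ m)
new (suc K) fzero    = old K fzero
new (suc K) (fsuc i) = new K i

f∃* : ∀ K {m} → Formula (K ⊕ m) → Formula m
f∃* zero    φ = φ
f∃* (suc K) φ = f∃ (f∃* K φ)

extend* : ∀ K {m} → (Fin K → Sub) → Env m → Env (K ⊕ m)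
extend* zero    xs ρ = ρ
extend* (suc K) xs ρ = extend* K (xs ∘ fsuc) (extend (xs fzero) ρ)

extend*-old : ∀ K {m} (xs : Fin K → Sub) (ρ : Env m) i → extend* K xs ρ (old K i) ≡ ρ i
extend*-old zero    xs ρ i = refl
extend*-old (suc K) xs ρ i = extend*-old K (xs ∘ fsuc) (extend (xs fzero) ρ) (fsuc i)

extend*-new : ∀ K {m} (xs : Fin K → Sub) (ρ : Env m) i → extend* K xs ρ (new K i) ≡ xs i
extend*-new (suc K) xs ρ fzero    = extend*-old K (xs ∘ fsuc) (extend (xs fzero) ρ) fzero
extend*-new (suc K) xs ρ (fsuc i) = extend*-new K (xs ∘ fsuc) (extend (xs fzero) ρ) i

⟦t⨆⟧ : ∀ {n} K (ts : Fin K → Term n) (ρ : Env n) → ⟦ t⨆ K ts ⟧t ρ ≡ ⨆ K (λ i → ⟦ ts i ⟧t ρ)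
⟦t⨆⟧ zero    ts ρ = refl
⟦t⨆⟧ (suc K) ts ρ = cong (⟦ ts fzero ⟧t ρ ⊔_) (⟦t⨆⟧ K (ts ∘ fsuc) ρ)

module _ (D : Sub → Set) where

  sat-⋀ : ∀ {n} K {φs : Fin K → Formula n} {ρ} → Sat D (⋀ K φs) ρ ⇔ (∀ i → Sat D (φs i) ρ)
  sat-⋀ zero    = mk⇔ (λ _ ()) (λ _ ff → ff)
  sat-⋀ (suc K) = mk⇔
    (λ { (p , q) fzero → p ; (p , q) (fsuc i) → to (sat-⋀ K) q i })
    (λ h → h fzero , from (sat-⋀ K) (h ∘ fsuc))

  sat-f∃* : ∀ K {m} {φ : Formula (K ⊕ m)} {ρ} →
    Sat D (f∃* K φ) ρ ⇔ Σ (Fin K → Sub) λ xs → (∀ i → D (xs i)) × Sat D φ (extend* K xs ρ)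
  sat-f∃* zero    = mk⇔ (λ p → (λ ()) , (λ ()) , p) (λ (_ , _ , p) → p)
  sat-f∃* (suc K) = mk⇔
    (λ (x , Dx , p) → let xs , Dxs , q = to (sat-f∃* K) p in
      (λ { fzero → x ; (fsuc i) → xs i }) , (λ { fzero → Dx ; (fsuc i) → Dxs i }) , q)
    (λ (xs , Dxs , q) → xs fzero , Dxs fzero , from (sat-f∃* K) (xs ∘ fsuc , Dxs ∘ fsuc , q))

-- The prescribed digraph is not part of the language: each edge is decided outside, and the formula
-- or its negation is asserted accordingly.
assert : ∀ {A : Set} {n} → Dec A → Formula n → Formula n
assert (yes _) φ = φ
assert (no _)  φ = f¬ φ

sat-assert : ∀ {D n} {A : Set} (d : Dec A) {φ : Formula n} {ρ} → Sat D (assert d φ) ρ ⇔ (Sat D φ ρ ⇔ A)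
sat-assert (yes a) = mk⇔ (λ p → mk⇔ (λ _ → a) (λ _ → p)) (λ h → from h a)
sat-assert (no ¬a) = mk⇔ (λ ¬p → mk⇔ (λ p → ⊥-elim (¬p p)) (λ a → ⊥-elim (¬a a))) (λ h p → ¬a (to h p))

unless : ∀ {A : Set} {n} → Dec A → Formula n → Formula n
unless (yes _) φ = f¬ f⊥
unless (no _)  φ = φ

sat-unless : ∀ {D n} {A : Set} (d : Dec A) {φ : Formula n} {ρ} → Sat D (unless d φ) ρ ⇔ (¬ A → Sat D φ ρ)
sat-unless (yes a) = mk⇔ (λ _ ¬a → ⊥-elim (¬a a)) (λ _ ff → ff)
sat-unless (no ¬a) = mk⇔ (λ p _ → p) (λ h → h ¬a)

-- What it takes for `p` to be a partition refining `a` along `π` with digraph `T`, apart from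
-- membership in 𝔸, which the language cannot express.
record Pattern {K m} (π : Fin K → Fin m) (T : Fin K → Fin K → Set)
               (p : Fin K → Sub) (a : Fin m → Sub) : Set where
  constructor pattern′
  field
    nonzero  : ∀ i → Nz (p i)
    disjoint : ∀ i j → i ≢ j → (p i ⊓ p j) ≈ 𝟎
    covers   : ⨆ K p ≈ 𝟏
    below    : ∀ i → p i ≤ᴮ a (π i)
    edges    : ∀ i j → Nz (σ (p i) ⊓ p j) ⇔ T i j

pattern-cong : ∀ {K m π T} {p q : Fin K → Sub} {a b : Fin m → Sub} →
  (∀ i → p i ≡ q i) → (∀ i → a i ≡ b i) → Pattern π T p a → Pattern π T q b
pattern-cong {K} {π = π} {T} p≡q a≡b (pattern′ nz dj cv bl ed) = pattern′
  (λ i → subst Nz (p≡q i) (nz i))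
  (λ i j i≢j → subst₂ (λ u v → (u ⊓ v) ≈ 𝟎) (p≡q i) (p≡q j) (dj i j i≢j))
  (subst (_≈ 𝟏) (⨆-cong K p≡q) cv)
  (λ i → subst₂ _≤ᴮ_ (p≡q i) (a≡b (π i)) (bl i))
  (λ i j → subst₂ (λ u v → Nz (σ u ⊓ v) ⇔ T i j) (p≡q i) (p≡q j) (ed i j))

module _ {K m} (π : Fin K → Fin m) {T : Fin K → Fin K → Set} (T? : ∀ i j → Dec (T i j)) where

  patternFormula : Formula (K ⊕ m)
  patternFormula =
    ⋀ K (λ i → f¬ (p i f≡ t𝟎)) f∧
    (⋀ K (λ i → ⋀ K λ j → unless (i ≟ᶠ j) ((p i t∧ p j) f≡ t𝟎)) f∧
    ((t⨆ K p f≡ t𝟏) f∧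
    (⋀ K (λ i → p i f≤ var (old K (π i))) f∧
    ⋀ K (λ i → ⋀ K λ j → assert (T? i j) (f¬ ((tσ (p i) t∧ p j) f≡ t𝟎))))))
    where
    p : Fin K → Term (K ⊕ m)
    p i = var (new K i)

  sat-patternFormula : ∀ {D} (ρ : Env (K ⊕ m)) →
    Sat D patternFormula ρ ⇔ Pattern π T (ρ ∘ new K) (ρ ∘ old K)
  sat-patternFormula {D} ρ = mk⇔
    (λ (nz , dj , cv , bl , ed) → pattern′
      (to (sat-⋀ D K) nz)
      (λ i j → to (sat-unless (i ≟ᶠ j)) (to (sat-⋀ D K) (to (sat-⋀ D K) dj i) j))
      (subst (_≈ 𝟏) (⟦t⨆⟧ K _ ρ) cv)
      (to (sat-⋀ D K) bl)
      (λ i j → to (sat-assert (T? i j)) (to (sat-⋀ D K) (to (sat-⋀ D K) ed i) j)))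
    (λ (pattern′ nz dj cv bl ed) →
      from (sat-⋀ D K) nz ,
      from (sat-⋀ D K) (λ i → from (sat-⋀ D K) λ j → from (sat-unless (i ≟ᶠ j)) (dj i j)) ,
      subst (_≈ 𝟏) (sym (⟦t⨆⟧ K _ ρ)) cv ,
      from (sat-⋀ D K) bl ,
      from (sat-⋀ D K) (λ i → from (sat-⋀ D K) λ j → from (sat-assert (T? i j)) (ed i j)))

-- The existential formula has only the `a i` as parameters, so its truth in 𝒫(ω)/Fin, witnessed by
-- `p`, passes to 𝔸 and yields witnesses there.
transfer-pattern : ∀ {InA} → ElementarySubstructure InA → ∀ {K m π} {T : Fin K → Fin K → Set} →
  (∀ i j → Dec (T i j)) → {p : Fin K → Sub} {a : Fin m → Sub} → (∀ i → InA (a i)) → Pattern π T p a →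
  Σ (Fin K → Sub) λ q → (∀ i → InA (q i)) × Pattern π T q a
transfer-pattern {InA} (_ , elementary) {K} {π = π} T? {p} {a} a∈ pat
  with to (sat-f∃* InA K) (from (elementary (f∃* K (patternFormula π T?)) a a∈)
    (from (sat-f∃* Everything K) (p , _ , from (sat-patternFormula π T? (extend* K p a))
      (pattern-cong (λ i → sym (extend*-new K p a i)) (λ i → sym (extend*-old K p a i)) pat))))
... | q , q∈ , sat = q , q∈ , pattern-cong (extend*-new K q a) (extend*-old K q a)
        (to (sat-patternFormula π T? (extend* K q a)) sat)

-- Ramsey's theorem and recurrent letters

module Classical (em : ExcludedMiddle 0ℓ) where

  frequently : ∀ {P : ℕ → Set} → ¬ Eventually (λ k → ¬ P k) → Frequently P
  frequently {P} h N with em {P = Σ ℕ λ k → N ≤ k × P k}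
  ... | yes p = p
  ... | no ¬p = ⊥-elim (h (N , λ k N≤k p → ¬p (k , N≤k , p)))

  Nz⇒frequently : ∀ {A} → Nz A → Frequently (λ k → A k ≡ true)
  Nz⇒frequently nzA = frequently λ (N , h) → nzA (N , λ k N≤k → ¬-not (h k N≤k))

  -- Ramsey's theorem for consecutive pairs only, which makes the induction on colours easy:
  -- either every late enough point has a later one joined to it by the top colour,
  -- or some subsequence avoids that colour.
  monochromatic-chain-along : ∀ K (c : ℕ → ℕ → ℕ) (h : ℕ → ℕ) → (∀ i → h i < h (suc i)) →
    (∀ {i j} → i < j → c (h i) (h j) < K) →
    Σ ℕ λ e → Σ (ℕ → ℕ) λ n → ∀ i → n i < n (suc i) × c (n i) (n (suc i)) ≡ e
  monochromatic-chain-along zero    c h inc bound = contradiction (bound {0} {1} (s≤s z≤n)) λ ()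
  monochromatic-chain-along (suc K) c h inc bound
    with em {P = Eventually λ i → Σ ℕ λ j → i < j × c (h i) (h j) ≡ K}
  ... | yes (N , succ) = K , h ∘ proj₁ ∘ walk , λ i →
          let j , i<j , eq = succ (proj₁ (walk i)) (proj₂ (walk i)) in step-mono-< h inc i<j , eq
    where
    walk : ℕ → Σ ℕ λ i → N ≤ i
    walk zero    = N , ≤-refl
    walk (suc i) with walk i
    ... | k , N≤k = proj₁ (succ k N≤k) , ≤-trans N≤k (<⇒≤ (proj₁ (proj₂ (succ k N≤k))))
  ... | no ¬ev = monochromatic-chain-along K c (h ∘ s)
          (λ i → step-mono-< h inc (s-inc i))
          (λ {i} {j} i<j → ≤∧≢⇒< (≤-pred (bound (step-mono-< s s-inc i<j)))
                              (λ eq → avoids i (s j , step-mono-< s s-inc i<j , eq)))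
    where
    Last : ℕ → Set
    Last i = ¬ (Σ ℕ λ j → i < j × c (h i) (h j) ≡ K)
    last∞ : Frequently Last
    last∞ = frequently λ (N , p) → ¬ev (N , λ k N≤k → decidable-stable em (p k N≤k))
    s : ℕ → ℕ
    s zero    = proj₁ (last∞ 0)
    s (suc i) = proj₁ (last∞ (suc (s i)))
    s-inc : ∀ i → s i < s (suc i)
    s-inc i = proj₁ (proj₂ (last∞ (suc (s i))))
    avoids : ∀ i → Last (s i)
    avoids zero    = proj₂ (proj₂ (last∞ 0))
    avoids (suc i) = proj₂ (proj₂ (last∞ (suc (s i))))

  monochromatic-chain : ∀ {K} (c : ℕ → ℕ → Fin K) →
    Σ (ℕ → ℕ) λ n → (∀ i → n i < n (suc i)) × (∀ i → c (n i) (n (suc i)) ≡ c (n 0) (n 1))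
  monochromatic-chain {K} c
    with monochromatic-chain-along K (λ a b → toℕ (c a b)) id n<1+n (λ _ → toℕ<n _)
  ... | e , n , p = n , proj₁ ∘ p , λ i → toℕ-injective (trans (proj₂ (p i)) (sym (proj₂ (p 0))))

  -- A letter that occurs only finitely often has a zero cell, which no partition allows. Such
  -- letters are removed one at a time.
  compress : ∀ {K} (s : ℕ → Fin K) →
    Σ ℕ λ K′ → Σ (ℕ → Fin K′) λ s′ → Σ (Fin K′ → Fin K) λ emb →
      Eventually (λ k → emb (s′ k) ≡ s k) × (∀ v → Frequently λ k → s′ k ≡ v)
  compress {zero}  s = ⊥-elim (¬Fin0 (s 0))
  compress {suc K} s with em {P = ∀ v → Frequently λ k → s k ≡ v}
  ... | yes all∞ = suc K , s , id , (0 , λ _ _ → refl) , all∞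
  ... | no ¬all∞ with em {P = Σ (Fin (suc K)) λ v → Eventually λ k → ¬ s k ≡ v}
  ...   | no ¬fin = ⊥-elim (¬all∞ λ v → frequently λ ev → ¬fin (v , ev))
  -- Positions before `N` read the letter at `N`, so that `v` never occurs and can be punched out.
  ...   | yes (v , N , s≢v) with compress {K} (λ k → punchOut {i = v} {j = s (k ⊔ⁿ N)} (λ eq → s≢v _ (m≤n⊔m k N) (sym eq)))
  ...     | K′ , s′ , emb , (M , agree) , all∞ = K′ , s′ , punchIn v ∘ emb , (M ⊔ⁿ N , agree′) , all∞
    where
    agree′ : ∀ k → M ⊔ⁿ N ≤ k → punchIn v (emb (s′ k)) ≡ s k
    agree′ k le = trans (cong (punchIn v) (agree k (≤-trans (m≤m⊔n M N) le)))
      (trans (punchIn-punchOut _) (cong s (m≥n⇒m⊔n≡m (≤-trans (m≤n⊔m M N) le))))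

  -- In the compressed word of consecutive pairs every letter recurs, in particular the one at
  -- position 0.
  frequent-transition : ∀ {K} (s : ℕ → Fin K) → Σ (Fin K) λ u → Σ (Fin K) λ v → FrequentTransition s u v
  frequent-transition {K} s with compress (λ k → Inverse.from *↔× (s k , s (suc k)))
  ... | _ , s′ , emb , (N , agree) , all∞ = proj₁ pair , proj₂ pair , freq
    where
    pair : Fin K × Fin K
    pair = Inverse.to *↔× (emb (s′ 0))
    freq : FrequentTransition s (proj₁ pair) (proj₂ pair)
    freq M with all∞ (s′ 0) (M ⊔ⁿ N)
    ... | k , le , eq = k , ≤-trans (m≤m⊔n M N) le , cong proj₁ here , cong proj₂ here
      where
      here : (s k , s (suc k)) ≡ pair
      here = trans (sym (Inverse.strictlyInverseˡ *↔× _))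
        (cong (Inverse.to *↔×) (trans (sym (agree k (≤-trans (m≤n⊔m M N) le))) (cong emb eq)))

  -- Subsets of a finite set are numbered, so that they can serve as Ramsey colours and as
  -- components of letters.
  module Coding {A : Set} {N} (index : A ↔ Fin N) where

    code : (A → Set) → Fin (2 ^ N)
    code P = funToFin λ i → Inverse.from 2↔Bool (does (em {P = P (Inverse.from index i)}))

    _∋_ : Fin (2 ^ N) → A → Set
    t ∋ a = finToFun t (Inverse.to index a) ≡ fsuc fzero

    module _ {P : A → Set} {a : A} where

      private
        a′ : A
        a′ = Inverse.from index (Inverse.to index a)

        a′≡a : a′ ≡ a
        a′≡a = Inverse.strictlyInverseʳ index a

        entry : finToFun (code P) (Inverse.to index a) ≡ Inverse.from 2↔Bool (does (em {P = P a′}))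
        entry = finToFun-funToFin _ (Inverse.to index a)

        does-sound : ∀ {X : Set} (d : Dec X) → Inverse.from 2↔Bool (does d) ≡ fsuc fzero → X
        does-sound (yes x) _ = x

      code-∋ : code P ∋ a ⇔ P a
      code-∋ = mk⇔
        (λ h → subst P a′≡a (does-sound em (trans (sym entry) h)))
        (λ p → trans entry (cong (Inverse.from 2↔Bool) (dec-true em (subst P (sym a′≡a) p))))

  -- Finite and infinite lifts of a word

  module Lifts {m n} (x : ℕ → Fin m) (φ : Fin n → Fin m) (E : Fin n → Fin n → Set) where

    record InfiniteLift : Set where
      field
        z     : ℕ → Fin n
        from₀ : ℕ
        over  : ∀ k → from₀ ≤ k → φ (z k) ≡ x k
        steps : ∀ k → from₀ ≤ k → E (z k) (z (suc k))
        every : ∀ {v v′} → E v v′ → FrequentTransition z v v′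

    -- The key (v , f , g , v′) stands for lifts from v to v′ which, if g is true, pass through the edge f.
    Key : Set
    Key = Fin n × (Fin n × Fin n) × Bool × Fin n

    -- Both ends `a` and `a + d` are included, so lifts over consecutive blocks share the vertex at
    -- the boundary. Values of `path` beyond `d` are irrelevant.
    record Lift (a d : ℕ) (key : Key) : Set where
      constructor lift
      private
        v  = proj₁ key
        f  = proj₁ (proj₂ key)
        g  = proj₁ (proj₂ (proj₂ key))
        v′ = proj₂ (proj₂ (proj₂ key))
      field
        path  : ℕ → Fin n
        start : path 0 ≡ v
        end   : path d ≡ v′
        over  : ∀ k → k ≤ d → φ (path k) ≡ x (a + k)
        steps : ∀ k → k < d → E (path k) (path (suc k))
        hit   : g ≡ true → Σ ℕ λ k → k < d × path k ≡ proj₁ f × path (suc k) ≡ proj₂ f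

    trivial-lift : ∀ {a v f} → φ v ≡ x a → Lift a 0 (v , f , false , v)
    trivial-lift {a} {v} eq = lift (λ _ → v) refl refl
      (λ { zero _ → trans eq (cong x (sym (+-identityʳ a))) }) (λ _ ()) λ ()

    -- Over a stretch without steps no edge is passed, so right at a boundary any demand must have
    -- been met by the complete blocks.
    trivial-lift-ends : ∀ {a v f g v′} → Lift a 0 (v , f , g , v′) → v ≡ v′ × g ≢ true
    trivial-lift-ends (lift _ s e _ _ h) = trans (sym s) e , λ eq → contradiction (proj₁ (proj₂ (h eq))) λ ()

    extend-lift : ∀ {a d v f g v′ g⁺ v⁺} → Lift a d (v , f , g , v′) → E v′ v⁺ → φ v⁺ ≡ x (a + suc d) →
      (g⁺ ≡ true → g ≡ true ⊎ (v′ ≡ proj₁ f × v⁺ ≡ proj₂ f)) → Lift a (suc d) (v , f , g⁺ , v⁺)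
    extend-lift {a} {d} {v} {f} {g} {v′} {g⁺} {v⁺} (lift path s e o st h) edge φv⁺ hit⁺ =
      lift path⁺ (trans (below z≤n) s) above over⁺ steps⁺ (λ g⁺≡ → hit′ (hit⁺ g⁺≡))
      where
      path⁺ : ℕ → Fin n
      path⁺ k = if does (k ≤? d) then path k else v⁺
      below : ∀ {k} → k ≤ d → path⁺ k ≡ path k
      below {k} k≤d = cong (if_then path k else v⁺) (dec-true (k ≤? d) k≤d)
      above : path⁺ (suc d) ≡ v⁺
      above = cong (if_then path (suc d) else v⁺) (dec-false (suc d ≤? d) 1+n≰n)
      over⁺ : ∀ k → k ≤ suc d → φ (path⁺ k) ≡ x (a + k)
      over⁺ k k≤ with m≤n⇒m<n∨m≡n k≤
      ... | inj₁ (s≤s k≤d) = trans (cong φ (below k≤d)) (o k k≤d)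
      ... | inj₂ refl      = trans (cong φ above) φv⁺
      last : path⁺ d ≡ v′
      last = trans (below ≤-refl) e
      steps⁺ : ∀ k → k < suc d → E (path⁺ k) (path⁺ (suc k))
      steps⁺ k (s≤s k≤d) with m≤n⇒m<n∨m≡n k≤d
      ... | inj₁ k<d  = subst₂ E (sym (below k≤d)) (sym (below k<d)) (st k k<d)
      ... | inj₂ refl = subst₂ E (sym last) (sym above) edge
      hit′ : g ≡ true ⊎ (v′ ≡ proj₁ f × v⁺ ≡ proj₂ f) →
        Σ ℕ λ k → k < suc d × path⁺ k ≡ proj₁ f × path⁺ (suc k) ≡ proj₂ f
      hit′ (inj₁ g≡) with h g≡
      ... | k , k<d , p , q = k , m<n⇒m<1+n k<d , trans (below (<⇒≤ k<d)) p , trans (below k<d) q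
      hit′ (inj₂ (p , q)) = d , ≤-refl , trans last p , trans above q

    keyIndex : Key ↔ Fin (n * ((n * n) * (2 * n)))
    keyIndex = ↔-× ↔-refl (↔-× (↔-× ↔-refl ↔-refl) (↔-× (↔-sym 2↔Bool) ↔-refl))

    -- Blocks of equal type

    module Blocks {T} (code : (Key → Set) → Fin T) (_∋_ : Fin T → Key → Set)
      (code-∋ : ∀ {P key} → code P ∋ key ⇔ P key)
      (s : ℕ → ℕ) (s-inc : ∀ i → s i < s (suc i))
      (mono : ∀ i → code (Lift (s i) (s (suc i) ∸ s i)) ≡ code (Lift (s 0) (s 1 ∸ s 0))) where

      gap : ℕ → ℕ
      gap i = s (suc i) ∸ suc (s i)

      s-suc : ∀ i → s (suc i) ≡ s i + suc (gap i)
      s-suc i = trans (sym (m+[n∸m]≡n (s-inc i))) (sym (+-suc (s i) (gap i)))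

      open Clock gap

      type : Fin T
      type = code (Lift (s 0) (s 1 ∸ s 0))

      type-∋ : ∀ i {key} → type ∋ key ⇔ Lift (s i) (suc (gap i)) key
      type-∋ i {key} = subst (λ t → t ∋ key ⇔ Lift (s i) (suc (gap i)) key)
        (trans (cong (λ d → code (Lift (s i) d)) (sym length≡)) (mono i)) code-∋
        where
        length≡ : s (suc i) ∸ s i ≡ suc (gap i)
        length≡ = trans (cong (_∸ s i) (s-suc i)) (m+n∸m≡n (s i) (suc (gap i)))

      -- Every block of x has the same type, so a step is liftable over each of them.
      BlockStep : Fin n → Fin n → Set
      BlockStep v v′ = Σ (Fin n × Fin n) λ f → Σ Bool λ g → type ∋ (v , f , g , v′)

      Through : Fin n × Fin n → ∀ {v v′} → BlockStep v v′ → Set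
      Through f (f′ , g , _) = f′ ≡ f × g ≡ true

      -- The `i`-th step of a block walk is lifted over block `i` of `x`, and each piece ends where
      -- the next one starts.
      module Assemble (v : ℕ → Fin n) (b : ∀ i → BlockStep (v i) (v (suc i)))
        (through∞ : ∀ {u u′} → E u u′ → Frequently λ i → Through (u , u′) (b i)) where

        piece : ∀ i → Lift (s i) (suc (gap i)) (v i , proj₁ (b i) , proj₁ (proj₂ (b i)) , v (suc i))
        piece i = to (type-∋ i) (proj₂ (proj₂ (b i)))

        walk : ℕ → Fin n
        walk j = Lift.path (piece (block (clock j))) (offset (clock j))

        walk-suc : ∀ j → walk (suc j) ≡ Lift.path (piece (block (clock j))) (suc (offset (clock j)))
        walk-suc j = go (clock j) (clock (suc j)) (clock-view j)
          where
          go : ∀ t t′ → Tick t t′ →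
            Lift.path (piece (block t′)) (offset t′) ≡ Lift.path (piece (block t)) (suc (offset t))
          go (time i d _) (time _ _ _) (inside refl refl)      = refl
          go (time i d _) (time _ _ _) (across refl refl refl) =
            trans (Lift.start (piece (suc i))) (sym (Lift.end (piece i)))

        walk-over : ∀ j → φ (walk j) ≡ x (s 0 + j)
        walk-over j = trans (Lift.over (piece _) (offset (clock j)) (≤-trans (offset≤gap j) (n≤1+n _)))
          (cong x (position s s-suc j))

        walk-steps : ∀ j → E (walk j) (walk (suc j))
        walk-steps j = subst (E (walk j)) (sym (walk-suc j))
          (Lift.steps (piece _) (offset (clock j)) (s≤s (offset≤gap j)))

        walk-every : ∀ {u u′} → E u u′ → FrequentTransition walk u u′
        walk-every {u} {u′} e N with through∞ e N
        ... | i , N≤i , ef , g≡ with Lift.hit (piece i) g≡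
        ... | d , s≤s d≤gap , p , q with visits-offset i d d≤gap
        ... | j , i≤j , at = j , ≤-trans N≤i i≤j
              , trans here (trans p (cong proj₁ ef))
              , trans (walk-suc j) (trans there (trans q (cong proj₂ ef)))
          where
          here : walk j ≡ Lift.path (piece i) d
          here = cong (λ t → Lift.path (piece (block t)) (offset t)) at
          there : Lift.path (piece (block (clock j))) (suc (offset (clock j))) ≡ Lift.path (piece i) (suc d)
          there = cong (λ t → Lift.path (piece (block t)) (suc (offset t))) at

        infinite-lift : InfiniteLift
        infinite-lift = record
          -- Positions before `s 0` receive `walk 0`; `from₀` discounts them.
          { z     = λ k → walk (k ∸ s 0)
          ; from₀ = s 0
          ; over  = λ k le → trans (walk-over (k ∸ s 0)) (cong x (m+[n∸m]≡n le))
          ; steps = λ k le → subst (E _) (cong walk (sym (+-∸-assoc 1 le))) (walk-steps (k ∸ s 0))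
          ; every = λ e N → let j , N≤j , p , q = walk-every e N in
              s 0 + j , ≤-trans N≤j (m≤n+m j (s 0))
              , trans (cong walk (m+n∸m≡n (s 0) j)) p
              , trans (cong walk (trans (cong (_∸ s 0) (sym (+-suc (s 0) j))) (m+n∸m≡n (s 0) (suc j)))) q
          }

      -- The word over this alphabet records x, the lifts available since the last block boundary, and the boundaries.
      Letter : Set
      Letter = Fin m × Fin T × Bool

      letterIndex : Letter ↔ Fin (m * (T * 2))
      letterIndex = ↔-× ↔-refl (↔-× ↔-refl (↔-sym 2↔Bool))

      isZero : ℕ → Bool
      isZero zero    = true
      isZero (suc _) = false

      typeOf : Letter → Fin T
      typeOf l = proj₁ (proj₂ l)

      retype : ∀ {l l′ key} → l ≡ l′ → typeOf l ∋ key → typeOf l′ ∋ key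
      retype refl t = t

      marked : Letter → Bool
      marked l = proj₂ (proj₂ l)

      letterOf : Time → Letter
      letterOf t = x (s (block t) + offset t) , code (Lift (s (block t)) (offset t)) , isZero (offset t)

      letterAt : ℕ → Letter
      letterAt j = letterOf (clock j)

      letterAt-over : ∀ j → proj₁ (letterAt j) ≡ x (s 0 + j)
      letterAt-over j = cong x (position s s-suc j)

      -- Walks in a common cover

      module CommonCover {K} (y : ℕ → Fin K) (name : Fin K → Letter)
        (named : Eventually λ j → name (y j) ≡ letterAt j) (y∞ : ∀ l → Frequently λ j → y j ≡ l)
        (W : Digraph) (strong : StronglyConnected W)
        (α : Fin (size W) → Fin n) (α-edge : ∀ v v′ → E v v′ ⇔
          Σ (Fin (size W)) λ w → Σ (Fin (size W)) λ w′ → α w ≡ v × α w′ ≡ v′ × edge W w w′)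
        (β : Fin (size W) → Fin K) (β-surj : Surjective β)
        (β-edge : ∀ {w w′} → edge W w w′ → FrequentTransition y (β w) (β w′))
        (square : ∀ w → φ (α w) ≡ proj₁ (name (β w))) where

        -- Each vertex of `W` stands for some actual time in `x`, although a walk in `W` need not
        -- follow `x`.
        occurrence : ∀ w → Σ ℕ λ j → name (β w) ≡ letterAt j
        occurrence w with y∞ (β w) (proj₁ named)
        ... | j , le , eq = j , trans (cong name (sym eq)) (proj₂ named j le)

        -- Along a walk in W, complete blocks of x have been lifted from v₀ to v₁, and an incomplete one
        -- from v₁ on; g asks that the edge f be passed somewhere.
        record Progress (f : Fin n × Fin n) (v₀ : Fin n) (g : Bool) (w : Fin (size W)) : Set where
          constructor progress
          field
            {v₁}   : Fin n
            {g₁}   : Bool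
            blocks : Star BlockStep v₀ v₁
            tail   : typeOf (name (β w)) ∋ (v₁ , f , g₁ , α w)
            hits   : g ≡ true → Uses (Through f) blocks ⊎ g₁ ≡ true

        module _ {f : Fin n × Fin n} {v₀ : Fin n} where

          begin : ∀ w → marked (name (β w)) ≡ true → v₀ ≡ α w → Progress f v₀ false w
          begin w mk refl with occurrence w
          ... | j , at = go (clock j) at
            where
            go : ∀ t → name (β w) ≡ letterOf t → Progress f v₀ false w
            go (time i zero _) at = progress {g₁ = false} ε
              (retype (sym at) (from code-∋ (trivial-lift (trans (square w) (trans (cong proj₁ at) (cong x (+-identityʳ (s i))))))))
              λ ()
            go (time i (suc d) _) at with trans (sym mk) (cong marked at)
            ... | ()

          -- At a boundary the incomplete block is empty, so the complete blocks alone form a loop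
          -- at `v₀` and must contain the demanded edge.
          finish : ∀ w → marked (name (β w)) ≡ true → v₀ ≡ α w → Progress f v₀ true w →
            Σ (Star BlockStep v₀ v₀) (Uses (Through f))
          finish w mk v₀≡ (progress {v₁} {g₁} p t h) with occurrence w
          ... | j , at = go (clock j) at
            where
            go : ∀ u → name (β w) ≡ letterOf u → Σ (Star BlockStep v₀ v₀) (Uses (Through f))
            go (time i zero _) at with trivial-lift-ends (to code-∋ (retype at t)) | h refl
            ... | v₁≡ , _  | inj₁ u  = subst (λ v → Σ (Star BlockStep v₀ v) (Uses (Through f))) (trans v₁≡ (sym v₀≡)) (p , u)
            ... | _   , g≢ | inj₂ g≡ = contradiction g≡ g≢
            go (time i (suc d) _) at with trans (sym mk) (cong marked at)
            ... | ()

          -- An edge of `W` projects to a transition occurring in `y` at some time `j`. The type in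
          -- the letter yields a lift in the block around `j`; it is extended by one edge and coded
          -- again, so different steps may use different blocks of `x`.
          advance : ∀ {w w′ g g⁺} → edge W w w′ →
            (g⁺ ≡ true → g ≡ true ⊎ (α w ≡ proj₁ f × α w′ ≡ proj₂ f)) →
            Progress f v₀ g w → Progress f v₀ g⁺ w′
          advance {w} {w′} {g} {g⁺} e hit (progress {v₁} {g₁} p t h) with β-edge e (proj₁ named)
          ... | j , le , eq , eq′ = go (clock j) (clock (suc j)) (clock-view j)
                  (trans (cong name (sym eq)) (proj₂ named j le))
                  (trans (cong name (sym eq′)) (proj₂ named (suc j) (≤-trans le (n≤1+n j))))
            where
            Names : Fin (size W) → Time → Set
            Names w t = name (β w) ≡ letterOf t
            αe : E (α w) (α w′)
            αe = from (α-edge _ _) (w , w′ , refl , refl , e)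
            -- A demand already met by complete blocks is dropped from the tail; otherwise the tail
            -- inherits it.
            carry : ∀ g⁺ → (g⁺ ≡ true → g ≡ true ⊎ (α w ≡ proj₁ f × α w′ ≡ proj₂ f)) →
              Σ Bool λ g₁⁺ → (g₁⁺ ≡ true → g₁ ≡ true ⊎ (α w ≡ proj₁ f × α w′ ≡ proj₂ f))
                   × (g⁺ ≡ true → Uses (Through f) p ⊎ g₁⁺ ≡ true)
            carry false _ = false , (λ ()) , λ ()
            carry true hit with hit refl
            ... | inj₂ now = true , (λ _ → inj₂ now) , λ _ → inj₂ refl
            ... | inj₁ g≡ with h g≡
            ...   | inj₁ u   = false , (λ ()) , λ _ → inj₁ u
            ...   | inj₂ g₁≡ = true , (λ _ → inj₁ g₁≡) , λ _ → inj₂ refl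
            hit₁ : _
            hit₁ = carry g⁺ hit
            longer : ∀ {i d} → code (Lift (s i) d) ∋ (v₁ , f , g₁ , α w) → φ (α w′) ≡ x (s i + suc d) →
              Lift (s i) (suc d) (v₁ , f , proj₁ hit₁ , α w′)
            longer t over = extend-lift (to code-∋ t) αe over (proj₁ (proj₂ hit₁))
            go : ∀ u u′ → Tick u u′ → Names w u → Names w′ u′ → Progress f v₀ g⁺ w′
            go (time i d _) (time _ _ _) (inside refl refl) at at′ = progress p
              (retype (sym at′)
                (from code-∋ (longer (retype at t) (trans (square w′) (cong proj₁ at′)))))
              (proj₂ (proj₂ hit₁))
            -- The tail now spans a whole block and becomes a block step, and a new empty tail
            -- begins.
            go (time i d _) (time _ _ _) (across refl refl refl) at at′ = progress {g₁ = false} (p ◅◅ (step ◅ ε))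
              (retype (sym at′) (from code-∋ (trivial-lift over′)))
              (λ g⁺≡ → inj₁ (used (proj₂ (proj₂ hit₁) g⁺≡)))
              where
              over′ : φ (α w′) ≡ x (s (suc i))
              over′ = trans (square w′) (trans (cong proj₁ at′) (cong x (+-identityʳ _)))
              step : BlockStep v₁ (α w′)
              step = f , proj₁ hit₁ , from (type-∋ i)
                (longer (retype at t) (trans over′ (cong x (s-suc i))))
              used : Uses (Through f) p ⊎ proj₁ hit₁ ≡ true → Uses (Through f) (p ◅◅ (step ◅ ε))
              used (inj₁ u)  = uses-◅◅ˡ (Through f) p u
              used (inj₂ g≡) = uses-◅◅ʳ (Through f) p (inj₁ (refl , g≡))

          advance* : ∀ {w w′ g} → Star (edge W) w w′ → Progress f v₀ g w → Progress f v₀ g w′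
          advance* ε       q = q
          advance* (e ◅ p) q = advance* p (advance e inj₁ q)

        -- By strong connectedness a walk in `W` leads from `w` to an edge above the given one,
        -- passes it and returns to `w`.
        loop-through : ∀ w → marked (name (β w)) ≡ true → ∀ {u u′} → E u u′ →
          Σ (Star BlockStep (α w) (α w)) (Uses (Through (u , u′)))
        loop-through w mk {u} {u′} e with to (α-edge u u′) e
        ... | a , a′ , αa , αa′ , aa′ = finish w mk refl
          (advance* (strong a′ w) (advance aa′ (λ _ → inj₂ (αa , αa′)) (advance* (strong w a) (begin w mk refl))))

        some-marked : Σ (Fin (size W)) λ w → marked (name (β w)) ≡ true
        -- Block `i` starts no earlier than time `i`, when `y` already names the true letters.
        some-marked = let i = proj₁ named ; j , i≤j , at = visits-offset i 0 z≤n ; w , βw≡ = β-surj (y j) in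
          w , cong marked (trans (cong name βw≡) (trans (proj₂ named j i≤j) (cong letterOf at)))

        infinite-lift : ∀ {u u′} → E u u′ → InfiniteLift
        infinite-lift {u} {u′} e₀ with some-marked
        ... | w , mk = go (proj₁ loop) (proj₂ loop)
          where
          edgeIndex : (Fin n × Fin n) ↔ Fin (n * n)
          edgeIndex = ↔-× ↔-refl ↔-refl
          edgeOf : Fin (n * n) → Fin n × Fin n
          edgeOf = Inverse.from edgeIndex
          IsEdge : Fin n × Fin n → Set
          IsEdge f = E (proj₁ f) (proj₂ f)
          each : ∀ i → Σ (Star BlockStep (α w) (α w)) λ p → IsEdge (edgeOf i) → Uses (Through (edgeOf i)) p
          each i with em {P = IsEdge (edgeOf i)}
          ... | yes e = let p , u = loop-through w mk e in p , λ _ → u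
          ... | no ¬e = ε , λ e → ⊥-elim (¬e e)
          loop : Σ (Star BlockStep (α w) (α w)) λ p → ∀ f → IsEdge f → Uses (Through f) p
          loop with collect-loops (IsEdge ∘ edgeOf) (λ i → Through (edgeOf i)) each
          ... | p , uses = p , λ f → subst (λ f → IsEdge f → Uses (Through f) p)
                  (Inverse.strictlyInverseʳ edgeIndex f) (uses (Inverse.to edgeIndex f))
          go : ∀ (p : Star BlockStep (α w) (α w)) → (∀ f → IsEdge f → Uses (Through f) p) → InfiniteLift
          -- The edge `e₀` rules out the empty loop, which could not be repeated.
          go ε       uses = ⊥-elim (uses (u , u′) e₀)
          go (b ◅ p) uses = Assemble.infinite-lift vertex edgeAt
            (λ {u} {u′} e → frequently-used (Through (u , u′)) (uses (u , u′) e))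
            where open Repeat b p

  -- From words to partitions in 𝔸

  cell-pattern : ∀ {InA} (P : Partition InA) {K} (s : ℕ → Fin K) (π : Fin K → Fin (card P)) →
    (∀ v → Frequently λ k → s k ≡ v) → Eventually (λ k → part P (π (s k)) k ≡ true) →
    Pattern π (FrequentTransition s) (cell s) (part P)
  cell-pattern P {K} s π s∞ (N , below) = pattern′
    (λ i → frequently⇒Nz λ M → let k , le , eq = s∞ i M in k , le , from (cell-true s) eq)
    (λ i j → cells-disjoint s)
    (0 , λ k _ → true-⨆ (cell s) (s k) (from (cell-true s) refl))
    (λ i → N , λ k le → under i k (below k le))
    (λ i j → mk⇔ (λ nz → transitions (Nz⇒frequently nz)) λ tr → frequently⇒Nz λ M →
      let k , le , p , q = tr M in
      suc k , ≤-trans le (n≤1+n k) , cong₂ _∧_ (from (cell-true s) p) (from (cell-true s) q))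
    where
    under : ∀ i k → part P (π (s k)) k ≡ true → (cell s i ⊓ (part P (π i) ᶜ)) k ≡ false
    under i k eq with s k ≟ᶠ i
    ... | yes refl = cong not eq
    ... | no _     = refl
    transitions : ∀ {i j} → Frequently (λ k → (σ (cell s i) ⊓ cell s j) k ≡ true) → FrequentTransition s i j
    -- The bound `suc M` excludes position 0 and leaves a predecessor that is at least `M`.
    transitions tr M with tr (suc M)
    ... | suc k , s≤s le , eq = let p , q = ∧-true eq in k , le , to (cell-true s) p , to (cell-true s) q

  -- The cells of `s` need not lie in 𝔸; transfer replaces them by elements of 𝔸 with the same
  -- digraph below the same parts.
  refine-along : ∀ {InA} → ElementarySubstructure InA → (P : Partition InA) → ∀ {K} (s : ℕ → Fin K)
    (π : Fin K → Fin (card P)) →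
    (∀ v → Frequently λ k → s k ≡ v) → Eventually (λ k → part P (π (s k)) k ≡ true) →
    Σ (Fin K → Sub) λ q → (∀ i → InA (q i)) × Pattern π (FrequentTransition s) q (part P)
  refine-along el P s π s∞ below = transfer-pattern el (λ i j → em) (inA P) (cell-pattern P s π s∞ below)

  partition : ∀ {InA K m π T} {a : Fin m → Sub} (q : Fin K → Sub) → (∀ i → InA (q i)) →
    Pattern π T q a → Partition InA
  partition {K = K} q q∈ (pattern′ nz dj cv _ _) = record
    { card = K ; part = q ; inA = q∈ ; nz = nz ; disj = dj ; cover = cv }

  -- Realization or obstruction

  module _ {InA} (el : ElementarySubstructure InA) (P : Partition InA) (R : VirtualRefinement P) where

    private
      x : ℕ → Fin (card P)
      x = proj₁ (word-of P)

      x-spec : Eventually λ k → ∀ i → part P i k ≡ true ⇔ x k ≡ i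
      x-spec = proj₂ (word-of P)

    open Lifts x (φ R) (edge (V R))

    below-word : ∀ {f : ℕ → Fin (card P)} → Eventually (λ k → f k ≡ x k) → Eventually λ k → part P (f k) k ≡ true
    below-word (M , h) = M ⊔ⁿ proj₁ x-spec , λ k le →
      from (proj₂ x-spec k (≤-trans (m≤n⊔m M _) le) _) (sym (h k (≤-trans (m≤m⊔n M _) le)))

    -- The recurrent transitions of the lift are exactly the edges of `V R`: each edge recurs, and
    -- from `from₀` on only edges occur.
    realize : InfiniteLift → Σ (Partition InA) λ P′ → Realizes P′ R
    realize L with refine-along el P z (φ R) z∞ (below-word (from₀ , over))
      where
      open InfiniteLift L
      out-edge : ∀ v → Σ _ (edge (V R) v)
      out-edge v with strong R v (z from₀)
      -- Here `v` is `z from₀` itself, and the lift supplies its out-edge.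
      ... | ε     = z (suc from₀) , steps from₀ ≤-refl
      ... | e ◅ _ = _ , e
      z∞ : ∀ v → Frequently λ k → z k ≡ v
      z∞ v N with every (proj₂ (out-edge v)) N
      ... | k , le , eq , _ = k , le , eq
    ... | q , q∈ , pat = partition q q∈ pat , φ R , Pattern.below pat , id
            , ((λ _ _ → id) , (λ v → v , refl) , (λ v v′ → mk⇔
              (λ e → from (Pattern.edges pat v v′) (every e))
              (λ nz → let k , le , p , p′ = to (Pattern.edges pat v v′) nz from₀ in
                subst₂ (edge (V R)) p p′ (steps k le))))
            , λ _ → refl
      where open InfiniteLift L

    -- A recurrent transition of `x` is an edge of the digraph of `P`, and an epimorphism lifts it
    -- to `V R`.
    some-edge : Σ _ λ v → Σ _ λ v′ → edge (V R) v v′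
    some-edge with frequent-transition x
    ... | a , b , tr with to (proj₂ (epi R) a b) (frequently⇒Nz λ N →
            let M , spec = x-spec ; k , le , p , q = tr (N ⊔ⁿ M) ; M≤k = ≤-trans (m≤n⊔m N M) le in
            suc k , ≤-trans (≤-trans (m≤m⊔n N M) le) (n≤1+n k) ,
            cong₂ _∧_ (from (spec k M≤k a) p) (from (spec (suc k) (≤-trans M≤k (n≤1+n k)) b) q))
    ...   | v , v′ , _ , _ , e = v , v′ , e

    module Obstruct {T} (code : (Key → Set) → Fin T) (_∋_ : Fin T → Key → Set)
      (code-∋ : ∀ {P key} → code P ∋ key ⇔ P key)
      (s : ℕ → ℕ) (s-inc : ∀ i → s i < s (suc i))
      (mono : ∀ i → code (Lift (s i) (s (suc i) ∸ s i)) ≡ code (Lift (s 0) (s 1 ∸ s 0))) where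

      open Blocks code _∋_ (λ {P} {key} → code-∋ {P} {key}) s s-inc mono

      obstruct : ¬ InfiniteLift → Σ (Partition InA) λ P′ → Σ (Fin (card P′) → Fin (card P)) λ π →
        IsNaturalMap P′ P π × ¬ Compatible (digraphOf P) (V R) (digraphOf P′) (φ R) π
      obstruct ¬L with compress (λ j → Inverse.to letterIndex (letterAt j))
      ... | K , y , emb , (N , agree) , y∞
        -- Letters are indexed by clock time, which starts at the boundary `s 0`; the shift brings
        -- them back to positions.
        with refine-along el P (λ k → y (k ∸ s 0)) (λ l → proj₁ (Inverse.from letterIndex (emb l)))
               shifted∞ (below-word (N + s 0 , over))
        where
        name : Fin K → Letter
        name l = Inverse.from letterIndex (emb l)
        shifted∞ : ∀ l → Frequently λ k → y (k ∸ s 0) ≡ l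
        shifted∞ l M with y∞ l M
        ... | j , le , eq = s 0 + j , ≤-trans le (m≤n+m j (s 0)) , trans (cong y (m+n∸m≡n (s 0) j)) eq
        over : ∀ k → N + s 0 ≤ k → proj₁ (name (y (k ∸ s 0))) ≡ x k
        over k le = trans (cong proj₁ (trans (cong (Inverse.from letterIndex) (agree (k ∸ s 0) (m+n≤o⇒m≤o∸n N le)))
          (Inverse.strictlyInverseʳ letterIndex _)))
          (trans (letterAt-over (k ∸ s 0)) (cong x (m+[n∸m]≡n (m+n≤o⇒n≤o N le))))
      ... | q , q∈ , pat = partition q q∈ pat , _ , Pattern.below pat , λ
        { (W , W-strong , α , α-epi , β , β-epi , square) → ¬L (CommonCover.infinite-lift
            y (λ l → Inverse.from letterIndex (emb l))
            (N , λ j le → trans (cong (Inverse.from letterIndex) (agree j le)) (Inverse.strictlyInverseʳ letterIndex _))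
            y∞ W W-strong α (proj₂ α-epi) β (proj₁ β-epi)
            (λ {w} {w′} e → unshift (to (Pattern.edges pat (β w) (β w′))
              (from (proj₂ β-epi (β w) (β w′)) (w , w′ , refl , refl , e))))
            square (proj₂ (proj₂ some-edge))) }
        where
        unshift : ∀ {l l′} → FrequentTransition (λ k → y (k ∸ s 0)) l l′ → FrequentTransition y l l′
        unshift tr M with tr (M + s 0)
        ... | k , le , p , p′ = k ∸ s 0 , m+n≤o⇒m≤o∸n M le , p
              , trans (cong y (sym (+-∸-assoc 1 (m+n≤o⇒n≤o M le)))) p′

    open Coding keyIndex

    polarized : Polarized R
    polarized with em {P = InfiniteLift}
    ... | yes L = inj₁ (realize L)
    -- The colour of two positions is the set of keys that can be lifted between them.
    ... | no ¬L with monochromatic-chain (λ a b → code (Lift a (b ∸ a)))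
    ...   | s , s-inc , mono = inj₂ (Obstruct.obstruct code _∋_ (λ {P} {key} → code-∋ {P} {key}) s s-inc mono ¬L)

theorem11p3 : ExcludedMiddle 0ℓ → (InA : Sub → Set) →
    ElementarySubstructure InA → PolarizedSystem InA
theorem11p3 em InA el P R = Classical.polarized em el P R
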